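{- Let $n,x$ be integers with $1<x<n$, so that $G=C_{2n}(x,1,n)$ is a $5$-regular circulant graph. If $n\equiv 1 \pmod 3$, $x\equiv 2\pmod 3$ and $2<x<\tfrac{n}{2}$, then $G$ is word-representable.
   Context: Two distinct letters $x,y$ alternate in a word $w$ if, after deleting all other letters from $w$, the resulting word is of the form $xyxy\cdots$ or $yxyx\cdots$ (of even or odd length). A graph $G=(V,E)$ is word-representable if there is a word $w$ over the alphabet $V$, containing every letter of $V$ at least once, such that for all distinct $x,y\in V$, $xy\in E$ if and only if $x$ and $y$ alternate in $w$. For an integer $m$ and a set $R$ of positive integers each at most $m/2$, the circulant graph $C_m(R)$ has vertex set $\{0,1,\dots,m-1\}$, with $i$ and $j$ adjacent iff $\min(|i-j|,\,m-|i-j|)\in R$. $C_{2n}(x,1,n)$ denotes the circulant graph on $2n$ vertices with jump set $\{1,x,n\}$; it is $5$-regular exactly when $1<x<n$. -}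

module Defs where

open import Level using (0ℓ)
open import Data.Nat using (ℕ; zero; suc; _∸_; _*_; _<_; _≤_; _⊓_; ∣_-_∣)
open import Data.Nat.Properties using (∣-∣-comm; ∣n-n∣≡0; <-trans; <⇒≤; ≤-refl; *-monoʳ-≤)
open import Data.Fin using (Fin; toℕ; _≟_)
open import Data.List using (List; []; _∷_; filter)
open import Data.List.Membership.Propositional using (_∈_)
open import Data.List.Relation.Unary.All using (All; []; _∷_; lookup)
open import Data.Product using (_×_; _,_; proj₁; ∃-syntax)
open import Data.Sum using (_⊎_)
open import Function.Bundles using (_⇔_)
open import Relation.Binary using (Rel; Symmetric; Irreflexive)
open import Relation.Binary.PropositionalEquality using (_≡_; _≢_; refl; subst)
open import Relation.Nullary using (contradiction)
open import Relation.Nullary.Decidable using (_⊎-dec_)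

record Graph (m : ℕ) : Set₁ where
  field
    Adj    : Rel (Fin m) 0ℓ
    sym    : Symmetric Adj
    irrefl : Irreflexive _≡_ Adj

Word : ℕ → Set
Word m = List (Fin m)

-- alternating a b k is the word abab⋯ of length k.
alternating : {A : Set} → A → A → ℕ → List A
alternating a b zero    = []
alternating a b (suc k) = a ∷ alternating b a k

restrict : ∀ {m} → Fin m → Fin m → Word m → Word m
restrict x y = filter (λ z → (z ≟ x) ⊎-dec (z ≟ y))

-- Only meaningful for distinct x and y.
Alternate : ∀ {m} → Fin m → Fin m → Word m → Set
Alternate x y w =
  ∃[ k ] (restrict x y w ≡ alternating x y k ⊎ restrict x y w ≡ alternating y x k)

Represents : ∀ {m} → Word m → Graph m → Set
Represents w G =
  (∀ x → x ∈ w) × (∀ x y → x ≢ y → Graph.Adj G x y ⇔ Alternate x y w)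

WordRepresentable : ∀ {m} → Graph m → Set
WordRepresentable G = ∃[ w ] Represents w G

-- A finite set of jumps, listed; order and repetition are irrelevant.
record JumpSet (m : ℕ) : Set where
  field
    jumps : List ℕ
    valid : All (λ r → 1 ≤ r × 2 * r ≤ m) jumps

circularDistance : ∀ {m} → Fin m → Fin m → ℕ
circularDistance {m} i j = ∣ toℕ i - toℕ j ∣ ⊓ (m ∸ ∣ toℕ i - toℕ j ∣)

circulant : (m : ℕ) → JumpSet m → Graph m
circulant m R = record
  { Adj    = λ i j → circularDistance i j ∈ jumps
  ; sym    = λ {i} {j} →
      subst (λ d → d ⊓ (m ∸ d) ∈ jumps) (∣-∣-comm (toℕ i) (toℕ j))
  ; irrefl = λ { {i} refl p → contradiction
      (proj₁ (lookup valid (subst (λ d → d ⊓ (m ∸ d) ∈ jumps) (∣n-n∣≡0 (toℕ i)) p)))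
      λ () }
  }
  where open JumpSet R

-- The circulant graph C₂ₙ(x,1,n).
C₂ₙ⟨_,1,_⟩ : (x n : ℕ) → 1 < x → x < n → Graph (2 * n)
C₂ₙ⟨ x ,1, n ⟩ 1<x x<n = circulant (2 * n) (record
  { jumps = x ∷ 1 ∷ n ∷ []
  ; valid = (<⇒≤ 1<x , *-monoʳ-≤ 2 (<⇒≤ x<n))
          ∷ (≤-refl  , *-monoʳ-≤ 2 1≤n)
          ∷ (1≤n     , ≤-refl)
          ∷ []
  })
  where
  1≤n : 1 ≤ n
  1≤n = <⇒≤ (<-trans 1<x x<n)

{-# OPTIONS --safe #-}

-- A 3-colourable graph is word-representable.  Writing the colour classes in the order 0, 1, 2
-- again and again makes all differently coloured letters alternate.  For a non-edge uv one
-- exchanges a single occurrence of u with a neighbouring one of v; as the letters of a class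
-- may be permuted freely, no other pair of differently coloured letters is affected.
-- Concatenating these words over all non-edges represents the graph.
--
-- The graph C₂ₙ(x,1,n) is 3-colourable: if multiplication by L sends each jump into the middle
-- third of ℤ/2n, then colouring i by the third in which i L lies is proper.  Any odd L sends n
-- to n.  With n = 3p + 1 and x = 3q + 2, start at L = 2p + 1, the least element of the middle
-- third, for which x L lies q + 1 above that third.  Raising L by 2 moves x L by 2x, and by 4
-- moves it by −(2n − 4x).  If x ≤ p then steps of 2x cannot jump over the third, and otherwise
-- steps of 2n − 4x cannot; either way x L gets there while L is still in the middle third.
module Submission where

open import Defs
open import Data.Bool using (Bool; true; false; _∧_; not; if_then_else_; T)
open import Data.Bool.Properties using (T?) renaming (_≟_ to _≟ᵇ_)
open import Data.Empty using (⊥-elim)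
open import Data.Fin using (Fin; toℕ; fromℕ<; _≟_) renaming (_<_ to _<ᶠ_; _≤_ to _≤ᶠ_)
open import Data.Fin.Patterns using (0F; 1F; 2F)
open import Data.Fin.Properties using (all?; <-cmp; toℕ<n; toℕ-fromℕ<)
  renaming (_<?_ to _<ᶠ?_; _≤?_ to _≤ᶠ?_; ≤-reflexive to ≤ᶠ-reflexive)
open import Data.List using (List; []; _∷_; _++_; map; concatMap; filter; allFin; cartesianProduct)
import Data.List.Membership.DecPropositional as DecMembership
open import Data.List.Membership.Propositional using (_∈_)
open import Data.List.Membership.Propositional.Properties
  using (∈-∃++; ∈-allFin; ∈-filter⁺; ∈-filter⁻; ∈-concatMap⁺; ∈-cartesianProduct⁺)
open import Data.List.Properties
  using (filter-++; filter-≐; filter-none; filter-accept; filter-reject; map-++; concatMap-++; ≡-dec)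
open import Data.List.Relation.Unary.All as All using (All; []; _∷_)
open import Data.List.Relation.Unary.Any as Any using (Any; here; there)
open import Data.List.Relation.Unary.Linked as Linked using (Linked; []; [-]; _∷_; linked?)
import Data.List.Relation.Unary.Linked.Properties as Linked
open import Data.List.Relation.Unary.Unique.Propositional using (Unique; _∷_)
open import Data.List.Relation.Unary.Unique.Propositional.Properties using (allFin⁺)
open import Data.Nat
  using (ℕ; zero; suc; _+_; _*_; _∸_; _⊓_; _/_; _%_; _≤_; _<_; _≰_; z≤n; s≤s; z<s; NonZero; _≤?_; _<?_)
  renaming (_≟_ to _≟ⁿ_)
open import Data.Nat.DivMod
  using (m≡m%n+[m/n]*n; m%n<n; m<n⇒m%n≡m; m≤n⇒[n∸m]%m≡n%m; [m+kn]%n≡m%n; %-congˡ;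
         n/n≡1; +-distrib-/-∣ʳ; /-monoˡ-≤; m<n*o⇒m/o<n)
open import Data.Nat.Divisibility using (∣-refl)
open import Data.Nat.Properties hiding (_≟_; _≤?_; _<?_; <-cmp)
open import Data.Nat.Tactic.RingSolver using (solve-∀)
open import Data.Product using (_×_; _,_; proj₁; proj₂; ∃-syntax)
open import Data.Sum using (inj₁; inj₂; swap)
open import Data.Unit using (tt)
open import Function using (_∘_; mk⇔)
open import Level using (Level)
open import Relation.Binary using (Decidable; tri<; tri≈; tri>)
open import Relation.Binary.PropositionalEquality
  using (_≡_; _≢_; refl; sym; trans; cong; cong₂; subst; subst₂; module ≡-Reasoning)
open import Relation.Nullary using (¬_; Dec; yes; no; does; contradiction)
open import Relation.Nullary.Decidable
  using (_×-dec_; _⊎-dec_; _→-dec_; ¬?; toWitness; map′; dec-true; dec-false)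
import Relation.Unary as U

private
  variable
    ℓ ℓ₁ ℓ₂ : Level
    A B : Set ℓ
    m : ℕ

-- Filtering and linked lists.

filter-filter : {P : U.Pred A ℓ₁} {Q : U.Pred A ℓ₂} (P? : U.Decidable P) (Q? : U.Decidable Q) →
  ∀ xs → filter P? (filter Q? xs) ≡ filter (λ z → Q? z ×-dec P? z) xs
filter-filter P? Q? [] = refl
filter-filter P? Q? (x ∷ xs) with does (Q? x)
... | false = filter-filter P? Q? xs
... | true  with does (P? x)
...   | false = filter-filter P? Q? xs
...   | true  = cong (x ∷_) (filter-filter P? Q? xs)

filter-≟-unique : {x : Fin m} {xs : List (Fin m)} → Unique xs → x ∈ xs → filter (_≟ x) xs ≡ x ∷ []
filter-≟-unique {x = x} (x≢xs ∷ _) (here refl) =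
  trans (filter-accept (_≟ x) refl)
        (cong (x ∷_) (filter-none (_≟ x) (All.map (λ x≢z z≡x → x≢z (sym z≡x)) x≢xs)))
filter-≟-unique {x = x} (z≢xs ∷ uniq) (there x∈xs) =
  trans (filter-reject (_≟ x) (All.lookup z≢xs x∈xs)) (filter-≟-unique uniq x∈xs)

Linked-++⁻ʳ : ∀ {R : A → A → Set ℓ₁} xs {ys} → Linked R (xs ++ ys) → Linked R ys
Linked-++⁻ʳ []       l = l
Linked-++⁻ʳ (x ∷ xs) l = Linked-++⁻ʳ xs (Linked.tail l)

Linked-++⁻ˡ : ∀ {R : A → A → Set ℓ₁} xs {ys} → Linked R (xs ++ ys) → Linked R xs
Linked-++⁻ˡ []           l       = []
Linked-++⁻ˡ (x ∷ [])     l       = [-]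
Linked-++⁻ˡ (x ∷ y ∷ xs) (r ∷ l) = r ∷ Linked-++⁻ˡ (y ∷ xs) l

-- Alternating words and their restrictions.

alternating-linked : {x y : A} → x ≢ y → ∀ k → Linked _≢_ (alternating x y k)
alternating-linked x≢y 0             = []
alternating-linked x≢y 1             = [-]
alternating-linked x≢y (suc (suc k)) = x≢y ∷ alternating-linked (x≢y ∘ sym) (suc k)

map-alternating : (f : A → B) (x y : A) → ∀ k → map f (alternating x y k) ≡ alternating (f x) (f y) k
map-alternating f x y zero    = refl
map-alternating f x y (suc k) = cong (f x ∷_) (map-alternating f y x k)

double : ℕ → ℕ
double zero    = zero
double (suc k) = suc (suc (double k))

-- Even length makes the first word end in y, so that the second may start with x.
alternating-++ : (x y : A) → ∀ k l →
  alternating x y (double k) ++ alternating x y (double l) ≡ alternating x y (double (k + l))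
alternating-++ x y zero    l = refl
alternating-++ x y (suc k) l = cong (λ w → x ∷ y ∷ w) (alternating-++ x y k l)

restrict-++ : (x y : Fin m) (w w′ : Word m) → restrict x y (w ++ w′) ≡ restrict x y w ++ restrict x y w′
restrict-++ x y = filter-++ (λ z → (z ≟ x) ⊎-dec (z ≟ y))

restrict-swap : (x y : Fin m) (w : Word m) → restrict x y w ≡ restrict y x w
restrict-swap x y = filter-≐ (λ z → (z ≟ x) ⊎-dec (z ≟ y)) (λ z → (z ≟ y) ⊎-dec (z ≟ x)) (swap , swap)

alternate-swap : {x y : Fin m} {w : Word m} → Alternate x y w → Alternate y x w
alternate-swap {x = x} {y} {w} (k , alt) rewrite restrict-swap x y w = k , swap alt

-- Having no two equal neighbours passes to contiguous parts of a word, so a single bad factor is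
-- enough to refute alternation.
alternate⇒linked : {x y : Fin m} (w : Word m) → x ≢ y → Alternate x y w → Linked _≢_ (restrict x y w)
alternate⇒linked w x≢y (k , inj₁ eq) rewrite eq = alternating-linked x≢y k
alternate⇒linked w x≢y (k , inj₂ eq) rewrite eq = alternating-linked (x≢y ∘ sym) k

-- The schedule of blocks and its finite verification.

-- The colour of a vertex z, followed by whether z = u and whether z = v.
Signature : Set
Signature = Fin 3 × Bool × Bool

-- A block contains the vertices whose signature it accepts. As only signatures matter, claims about
-- the schedule are finite checks, whatever the graph.
Block : Set
Block = Signature → Bool

_∩u _∖u _∩v _∖v : Fin 3 → Block
(k ∩u) (c , isU , isV) = does (k ≟ c) ∧ isU
(k ∖u) (c , isU , isV) = does (k ≟ c) ∧ not isU
(k ∩v) (c , isU , isV) = does (k ≟ c) ∧ isV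
(k ∖v) (c , isU , isV) = does (k ≟ c) ∧ not isV

-- Letters of distinct colours alternate, except that a u of colour i and a v of colour j > i are
-- exchanged once: on the first line for (i , j) = (0 , 1), on the second for (1 , 2), and across
-- the last two for (0 , 2).  The splitting of the other blocks makes u and v fail to alternate
-- when they share a colour.
schedule : List Block
schedule =
    (0F ∖u) ∷ (1F ∩v) ∷ (0F ∩u) ∷ (1F ∖v) ∷ (2F ∖v) ∷ (2F ∩v)
  ∷ (0F ∖u) ∷ (0F ∩u) ∷ (1F ∖u) ∷ (2F ∩v) ∷ (1F ∩u) ∷ (2F ∖v)
  ∷ (0F ∖u) ∷ (0F ∩u) ∷ (1F ∩u) ∷ (1F ∖u) ∷ (2F ∖v)
  ∷ (0F ∩u) ∷ (2F ∩v) ∷ (0F ∖u) ∷ (1F ∩u) ∷ (1F ∖u) ∷ (2F ∩v) ∷ (2F ∖v) ∷ []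

-- Two letters in one block would appear in the order of `allFin`, which signatures do not
-- determine; the order of separated letters is determined by the blocks.
Separates : Signature → Signature → Block → Set
Separates σ τ b = b σ ∧ b τ ≡ false

blockTrace : Bool → Bool → List Bool
blockTrace s t = (if s then true ∷ [] else []) ++ (if t then false ∷ [] else [])

-- true stands for a letter of signature σ, false for one of signature τ.
trace : Signature → Signature → List Block → List Bool
trace σ τ = concatMap (λ b → blockTrace (b σ) (b τ))

∀Bool? : {P : Bool → Set ℓ₁} → (∀ b → Dec (P b)) → Dec (∀ b → P b)
∀Bool? P? = map′ (λ { (t , f) true → t ; (t , f) false → f }) (λ h → h true , h false)
                 (P? true ×-dec P? false)

-- The excluded case, `su` and `tv` both true, is the pair u, v that the schedule is meant to break.
-- Every signature lies in four blocks, whence the length 8.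
Preserves : Fin 3 → Fin 3 → Bool → Bool → Bool → Bool → Set
Preserves i j su sv tu tv = i <ᶠ j → su ∧ tv ≡ false →
  All (Separates σ τ) schedule × trace σ τ schedule ≡ alternating true false 8
  where
  σ τ : Signature
  σ = i , su , sv
  τ = j , tu , tv

schedule-preserves : ∀ i j su sv tu tv → Preserves i j su sv tu tv
schedule-preserves = toWitness {a? = all? λ i → all? λ j →
  ∀Bool? λ su → ∀Bool? λ sv → ∀Bool? λ tu → ∀Bool? λ tv →
  (i <ᶠ? j) →-dec ((su ∧ tv ≟ᵇ false) →-dec
    (All.all? (λ b → _ ≟ᵇ _) schedule ×-dec ≡-dec _≟ᵇ_ _ _))} tt

schedule-breaks : ∀ i j → i ≤ᶠ j →
  let σ = i , true , false
      τ = j , false , true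
  in All (Separates σ τ) schedule × ¬ Linked _≢_ (trace σ τ schedule)
schedule-breaks = toWitness {a? = all? λ i → all? λ j →
  (i ≤ᶠ? j) →-dec
    (All.all? (λ b → _ ≟ᵇ _) schedule ×-dec ¬? (linked? (λ s t → ¬? (s ≟ᵇ t)) _))} tt

-- From schedules to words.

letter : (x y : Fin m) → Bool → Fin m
letter x y b = if b then x else y

letter-injective : {x y : Fin m} → x ≢ y → ∀ {s t} → letter x y s ≡ letter x y t → s ≡ t
letter-injective x≢y {false} {false} _ = refl
letter-injective x≢y {true}  {true}  _ = refl
letter-injective x≢y {true}  {false} e = contradiction e x≢y
letter-injective x≢y {false} {true}  e = contradiction (sym e) x≢y

block : (Fin m → Bool) → Word m
block P = filter (T? ∘ P) (allFin _)

-- At most one of x and y lies in the block, and `allFin` lists it once, so at most one letter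
-- survives.
restrict-block : (x y : Fin m) (P : Fin m → Bool) → P x ∧ P y ≡ false →
  restrict x y (block P) ≡ map (letter x y) (blockTrace (P x) (P y))
restrict-block {m} x y P sep =
  trans (filter-filter _ _ (allFin m)) (go (P x) (P y) refl refl sep)
  where
  Q? = λ z → T? (P z) ×-dec ((z ≟ x) ⊎-dec (z ≟ y))

  T⁺ : ∀ {b} → b ≡ true → T b
  T⁺ refl = tt

  ¬T : ∀ {b} → b ≡ false → ¬ T b
  ¬T refl ()

  go : ∀ s t → P x ≡ s → P y ≡ t → s ∧ t ≡ false → filter Q? (allFin m) ≡ map (letter x y) (blockTrace s t)
  go true true px py ()
  go true false px py _ = trans
    (filter-≐ Q? (_≟ x)
      ( (λ { (_ , inj₁ z≡x) → z≡x ; (pz , inj₂ refl) → ⊥-elim (¬T py pz) })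
      , λ { refl → T⁺ px , inj₁ refl })
      (allFin m))
    (filter-≟-unique (allFin⁺ m) (∈-allFin x))
  go false true px py _ = trans
    (filter-≐ Q? (_≟ y)
      ( (λ { (_ , inj₂ z≡y) → z≡y ; (pz , inj₁ refl) → ⊥-elim (¬T px pz) })
      , λ { refl → T⁺ py , inj₂ refl })
      (allFin m))
    (filter-≟-unique (allFin⁺ m) (∈-allFin y))
  go false false px py _ = filter-none Q? (All.universal
    (λ { z (pz , inj₁ refl) → ¬T px pz ; z (pz , inj₂ refl) → ¬T py pz }) (allFin m))

module _ (sig : Fin m → Signature) where

  realise : List Block → Word m
  realise = concatMap (λ b → block (b ∘ sig))

  restrict-realise : (x y : Fin m) (bs : List Block) → All (Separates (sig x) (sig y)) bs →
    restrict x y (realise bs) ≡ map (letter x y) (trace (sig x) (sig y) bs)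
  restrict-realise x y []       []           = refl
  restrict-realise x y (b ∷ bs) (sep ∷ seps) = begin
    restrict x y (block (b ∘ sig) ++ realise bs)
      ≡⟨ restrict-++ x y (block (b ∘ sig)) (realise bs) ⟩
    restrict x y (block (b ∘ sig)) ++ restrict x y (realise bs)
      ≡⟨ cong₂ _++_ (restrict-block x y (b ∘ sig) sep) (restrict-realise x y bs seps) ⟩
    map (letter x y) bt ++ map (letter x y) (trace (sig x) (sig y) bs)
      ≡⟨ map-++ (letter x y) bt _ ⟨
    map (letter x y) (trace (sig x) (sig y) (b ∷ bs)) ∎
    where
    open ≡-Reasoning
    bt = blockTrace (b (sig x)) (b (sig y))

-- Representing a 3-coloured graph.

module _ (G : Graph m) (adj? : Decidable (Graph.Adj G))
         (colour : Fin m → Fin 3) (proper : ∀ {x y} → Graph.Adj G x y → colour x ≢ colour y) where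
  open Graph G using (Adj) renaming (sym to adj-sym; irrefl to adj-irrefl)

  signature : Fin m × Fin m → Fin m → Signature
  signature (u , v) z = colour z , does (z ≟ u) , does (z ≟ v)

  factor : Fin m × Fin m → Word m
  factor uv = realise (signature uv) schedule

  nonAdj? : U.Decidable {A = Fin m × Fin m} (λ (u , v) → ¬ Adj u v)
  nonAdj? (u , v) = ¬? (adj? u v)

  nonEdges : List (Fin m × Fin m)
  nonEdges = filter nonAdj? (cartesianProduct (allFin m) (allFin m))

  ∈-nonEdges : ∀ {u v} → ¬ Adj u v → (u , v) ∈ nonEdges
  ∈-nonEdges ¬uv = ∈-filter⁺ nonAdj? (∈-cartesianProduct⁺ (∈-allFin _) (∈-allFin _)) ¬uv

  word : Word m
  word = concatMap factor nonEdges

  restrict-factor-adj : ∀ {x y} u v → colour x <ᶠ colour y → Adj x y → ¬ Adj u v →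
    restrict x y (factor (u , v)) ≡ alternating x y 8
  restrict-factor-adj {x} {y} u v cx<cy xy ¬uv =
    let seps , tr = schedule-preserves (colour x) (colour y) _ _ _ _ cx<cy flags
    in trans (restrict-realise (signature (u , v)) x y schedule seps)
         (trans (cong (map (letter x y)) tr) (map-alternating (letter x y) true false 8))
    where
    flags : does (x ≟ u) ∧ does (y ≟ v) ≡ false
    -- With x = u and y = v the edge xy would be the non-edge uv.
    flags with x ≟ u | y ≟ v
    ... | yes refl | yes refl = contradiction xy ¬uv
    ... | yes _    | no _     = refl
    ... | no _     | _        = refl

  restrict-factors-adj : ∀ {x y} → colour x <ᶠ colour y → Adj x y → ∀ {uvs} →
    All (λ (u , v) → ¬ Adj u v) uvs →
    ∃[ k ] restrict x y (concatMap factor uvs) ≡ alternating x y (double k)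
  restrict-factors-adj cx<cy xy [] = 0 , refl
  restrict-factors-adj {x} {y} cx<cy xy {(u , v) ∷ uvs} (¬uv ∷ ¬uvs) =
    let k , eq = restrict-factors-adj cx<cy xy ¬uvs
    in 4 + k ,
       trans (restrict-++ x y (factor (u , v)) (concatMap factor uvs))
         (trans (cong₂ _++_ (restrict-factor-adj u v cx<cy xy ¬uv) eq)
                (alternating-++ x y 4 k))

  -- Equal neighbours in the trace stay equal under `letter x y`, so the failure found by the finite
  -- check persists in the word.
  factor-not-linked : ∀ {x y} → x ≢ y → colour x ≤ᶠ colour y →
    ¬ Linked _≢_ (restrict x y (factor (x , y)))
  factor-not-linked {x} {y} x≢y cx≤cy linked =
    let eq = restrict-realise (signature (x , y)) x y schedule (subst₂ Sep sx sy (proj₁ broken))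
    in proj₂ broken
         (subst₂ (λ σ τ → Linked _≢_ (trace σ τ schedule)) (sym sx) (sym sy)
           (Linked.map (λ ne e → ne (cong (letter x y) e))
             (Linked.map⁻ (subst (Linked _≢_) eq linked))))
    where
    Sep : Signature → Signature → Set
    Sep σ τ = All (Separates σ τ) schedule

    broken = schedule-breaks (colour x) (colour y) cx≤cy

    sx : (colour x , true , false) ≡ signature (x , y) x
    sx = sym (cong₂ (λ s t → colour x , s , t) (dec-true (x ≟ x) refl) (dec-false (x ≟ y) x≢y))

    sy : (colour y , false , true) ≡ signature (x , y) y
    sy = sym (cong₂ (λ s t → colour y , s , t) (dec-false (y ≟ x) (x≢y ∘ sym)) (dec-true (y ≟ y) refl))

  restrict-word-adj : ∀ {x y} → colour x <ᶠ colour y → Adj x y →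
    ∃[ k ] restrict x y word ≡ alternating x y (double k)
  restrict-word-adj cx<cy xy = restrict-factors-adj cx<cy xy
    (All.tabulate (proj₂ ∘ ∈-filter⁻ nonAdj? {xs = cartesianProduct (allFin m) (allFin m)}))

  adj⇒alternate : ∀ {x y} → Adj x y → Alternate x y word
  adj⇒alternate {x} {y} xy with <-cmp (colour x) (colour y)
  ... | tri≈ _ cx≡cy _ = contradiction cx≡cy (proper xy)
  ... | tri< cx<cy _ _ = let k , eq = restrict-word-adj cx<cy xy in double k , inj₁ eq
  ... | tri> _ _ cy<cx = let k , eq = restrict-word-adj cy<cx (adj-sym xy)
                         in alternate-swap {w = word} (double k , inj₁ eq)

  alternate⇒factor-linked : ∀ {x y} → x ≢ y → Alternate x y word → ∀ {uv} → uv ∈ nonEdges →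
    Linked _≢_ (restrict x y (factor uv))
  alternate⇒factor-linked {x} {y} x≢y alt {uv} uv∈ with ∈-∃++ uv∈
  ... | ps , qs , eq = Linked-++⁻ˡ (R (factor uv)) (Linked-++⁻ʳ (R (concatMap factor ps))
          (subst (Linked _≢_) split (alternate⇒linked word x≢y alt)))
    where
    open ≡-Reasoning
    R = restrict x y
    split : R word ≡ R (concatMap factor ps) ++ (R (factor uv) ++ R (concatMap factor qs))
    split = begin
      R word                                              ≡⟨ cong (R ∘ concatMap factor) eq ⟩
      R (concatMap factor (ps ++ uv ∷ qs))                ≡⟨ cong R (concatMap-++ factor ps (uv ∷ qs)) ⟩
      R (concatMap factor ps ++ concatMap factor (uv ∷ qs)) ≡⟨ restrict-++ x y (concatMap factor ps) _ ⟩
      R (concatMap factor ps) ++ R (factor uv ++ concatMap factor qs)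
        ≡⟨ cong (R (concatMap factor ps) ++_) (restrict-++ x y (factor uv) _) ⟩
      R (concatMap factor ps) ++ (R (factor uv) ++ R (concatMap factor qs)) ∎

  alternate⇒adj : ∀ {x y} → x ≢ y → Alternate x y word → Adj x y
  alternate⇒adj {x} {y} x≢y alt with adj? x y
  ... | yes xy = xy
  ... | no ¬xy with <-cmp (colour x) (colour y)
  ...   | tri< c _ _ = contradiction (alternate⇒factor-linked x≢y alt (∈-nonEdges ¬xy))
                                     (factor-not-linked x≢y (<⇒≤ c))
  ...   | tri≈ _ c _ = contradiction (alternate⇒factor-linked x≢y alt (∈-nonEdges ¬xy))
                                     (factor-not-linked x≢y (≤ᶠ-reflexive c))
  -- `nonEdges` holds a pair in both orders; the factor with the lower colour first is the one known
  -- to break.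
  ...   | tri> _ _ c = contradiction
          (alternate⇒factor-linked (x≢y ∘ sym) (alternate-swap {w = word} alt)
            (∈-nonEdges (¬xy ∘ adj-sym)))
          (factor-not-linked (x≢y ∘ sym) (<⇒≤ c))

  -- By irreflexivity (x , x) counts as a non-edge, so the word has a factor even for a complete
  -- graph.
  ∈-word : ∀ x → x ∈ word
  ∈-word x = ∈-concatMap⁺ factor (Any.map (λ { refl → ∈-factor }) (∈-nonEdges (adj-irrefl refl)))
    where
    σ = signature (x , x)

    occurs : ∀ c s → Any (λ b → T (b (c , s , s))) schedule
    occurs = toWitness {a? = all? λ c → ∀Bool? λ s → Any.any? (λ b → T? _) schedule} tt

    ∈-factor : x ∈ factor (x , x)
    ∈-factor = ∈-concatMap⁺ (λ b → block (b ∘ σ))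
      (Any.map (λ {b} → ∈-filter⁺ (T? ∘ b ∘ σ) (∈-allFin x)) (occurs (colour x) _))

  colourable₃⇒wordRepresentable : WordRepresentable G
  colourable₃⇒wordRepresentable =
    word , ∈-word , λ x y x≢y → mk⇔ adj⇒alternate (alternate⇒adj x≢y)

-- Arcs of a circle.

-- The circular distance of D from 0 modulo M is at least h.
Far : ℕ → ℕ → ℕ → Set
Far h M D = ∃[ k ] ∃[ r ] D ≡ r + k * M × h ≤ r × r + h ≤ M

/-strict : ∀ {h u v} .{{_ : NonZero h}} → u + h ≤ v → u / h < v / h
/-strict {h} {u} {v} u+h≤v = begin-strict
  u / h           <⟨ n<1+n (u / h) ⟩
  suc (u / h)     ≡⟨ +-comm 1 (u / h) ⟩
  u / h + 1       ≡⟨ cong (u / h +_) (n/n≡1 h) ⟨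
  u / h + h / h   ≡⟨ +-distrib-/-∣ʳ u ∣-refl ⟨
  (u + h) / h     ≤⟨ /-monoˡ-≤ h u+h≤v ⟩
  v / h           ∎
  where open ≤-Reasoning

module _ (h M : ℕ) .{{_ : NonZero h}} .{{_ : NonZero M}} where

  -- The circle of M residues is cut at the multiples of h; the last arc may be shorter.
  arc : ℕ → ℕ
  arc a = a % M / h

  arc-periodic : ∀ a k → arc (a + k * M) ≡ arc a
  arc-periodic a k = cong (_/ h) ([m+kn]%n≡m%n a k M)

  reduce : ∀ a r k → (a + (r + k * M)) % M ≡ (a % M + r) % M
  reduce a r k = begin
    (a + (r + k * M)) % M     ≡⟨ cong (_% M) (+-assoc a r (k * M)) ⟨
    (a + r + k * M) % M       ≡⟨ [m+kn]%n≡m%n (a + r) k M ⟩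
    (a + r) % M               ≡⟨ %-congˡ (cong (_+ r) (m≡m%n+[m/n]*n a M)) ⟩
    (a % M + a / M * M + r) % M  ≡⟨ %-congˡ (solve-+ (a % M) (a / M * M) r) ⟩
    (a % M + r + a / M * M) % M  ≡⟨ [m+kn]%n≡m%n (a % M + r) (a / M) M ⟩
    (a % M + r) % M           ∎
    where
    open ≡-Reasoning
    solve-+ : ∀ i j l → i + j + l ≡ i + l + j
    solve-+ = solve-∀

  -- Adding r raises the residue by at least h if it does not wrap around, and otherwise lowers it
  -- by M - r, again at least h. Either way it leaves its arc.
  arc-≢ : ∀ a D → Far h M D → arc a ≢ arc (a + D)
  arc-≢ a D (k , r , refl , h≤r , r+h≤M) eq with a % M + r <? M
  ... | yes u+r<M = <⇒≢ (/-strict {h} (+-monoʳ-≤ (a % M) h≤r))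
          (trans eq (cong (_/ h) (trans (reduce a r k) (m<n⇒m%n≡m u+r<M))))
  ... | no u+r≮M = <⇒≢ (/-strict {h} v+h≤u) (sym (trans eq (cong (_/ h) (trans (reduce a r k) wrap))))
    where
    u = a % M
    v = u + r ∸ M
    M≤u+r = ≮⇒≥ u+r≮M
    v+h≤u : v + h ≤ u
    v+h≤u = +-cancelʳ-≤ r (v + h) u (begin
      v + h + r     ≡⟨ +-assoc v h r ⟩
      v + (h + r)   ≡⟨ cong (v +_) (+-comm h r) ⟩
      v + (r + h)   ≤⟨ +-monoʳ-≤ v r+h≤M ⟩
      v + M         ≡⟨ m∸n+n≡m M≤u+r ⟩
      u + r         ∎)
      where open ≤-Reasoning
    wrap : (u + r) % M ≡ v
    wrap = trans (sym (m≤n⇒[n∸m]%m≡n%m M≤u+r))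
      (m<n⇒m%n≡m (≤-<-trans (≤-trans (m≤m+n v h) v+h≤u) (m%n<n a M)))

  arc<3 : M ≤ 3 * h → ∀ a → arc a < 3
  arc<3 M≤3h a = m<n*o⇒m/o<n (<-≤-trans (m%n<n a M) M≤3h)

-- Colouring circulant graphs by arcs.

module _ (m : ℕ) (jumps : List ℕ) (h L : ℕ) .{{_ : NonZero h}} .{{_ : NonZero m}}
         (m≤3h : m ≤ 3 * h) (far : ∀ {d} → d ∈ jumps → Far h m (d * L)) where

  arcColour : Fin m → Fin 3
  arcColour i = fromℕ< (arc<3 h m m≤3h (toℕ i * L))

  arc-proper : ∀ a d → d < m → d ⊓ (m ∸ d) ∈ jumps → arc h m (a * L) ≢ arc h m ((a + d) * L)
  arc-proper a d d<m d∈ eq with ≤-total d (m ∸ d)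
  ... | inj₁ le = arc-≢ h m (a * L) (d * L) (far (subst (_∈ jumps) (m≤n⇒m⊓n≡m le) d∈))
          (trans eq (cong (arc h m) (*-distribʳ-+ L a d)))
  -- The jump m - d leads from a + d to a + m, which has the arc of a since m L vanishes modulo m.
  ... | inj₂ ge = arc-≢ h m ((a + d) * L) ((m ∸ d) * L) (far (subst (_∈ jumps) (m≥n⇒m⊓n≡n ge) d∈))
          (begin
            arc h m ((a + d) * L)                   ≡⟨ eq ⟨
            arc h m (a * L)                         ≡⟨ arc-periodic h m (a * L) L ⟨
            arc h m (a * L + L * m)                 ≡⟨ cong (λ z → arc h m (a * L + L * z)) (m+[n∸m]≡n (<⇒≤ d<m)) ⟨
            arc h m (a * L + L * (d + (m ∸ d)))     ≡⟨ cong (arc h m) (ring a d (m ∸ d) L) ⟩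
            arc h m ((a + d) * L + (m ∸ d) * L)     ∎)
    where
    open ≡-Reasoning
    ring : ∀ a d e L → a * L + L * (d + e) ≡ (a + d) * L + e * L
    ring = solve-∀

  arcColour-proper-≤ : ∀ {i j} → toℕ i ≤ toℕ j → circularDistance i j ∈ jumps → arcColour i ≢ arcColour j
  arcColour-proper-≤ {i} {j} i≤j d∈ eq = arc-proper (toℕ i) d
      (≤-<-trans (m∸n≤m (toℕ j) (toℕ i)) (toℕ<n j))
      (subst (λ e → e ⊓ (m ∸ e) ∈ jumps) (m≤n⇒∣m-n∣≡n∸m i≤j) d∈)
      (begin
        arc h m (toℕ i * L)          ≡⟨ toℕ-fromℕ< _ ⟨
        toℕ (arcColour i)            ≡⟨ cong toℕ eq ⟩
        toℕ (arcColour j)            ≡⟨ toℕ-fromℕ< _ ⟩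
        arc h m (toℕ j * L)          ≡⟨ cong (λ z → arc h m (z * L)) (m+[n∸m]≡n i≤j) ⟨
        arc h m ((toℕ i + d) * L)    ∎)
    where
    open ≡-Reasoning
    d = toℕ j ∸ toℕ i

  arcColour-proper : ∀ {i j} → circularDistance i j ∈ jumps → arcColour i ≢ arcColour j
  arcColour-proper {i} {j} d∈ with ≤-total (toℕ i) (toℕ j)
  ... | inj₁ i≤j = arcColour-proper-≤ i≤j d∈
  ... | inj₂ j≤i = arcColour-proper-≤ j≤i
          (subst (λ d → d ⊓ (m ∸ d) ∈ jumps) (∣-∣-comm (toℕ i) (toℕ j)) d∈) ∘ sym

-- Finding the multiplier.

-- For n = 3 p + 1 and x = 3 q + 2, an odd L = 2 p + 1 + 2 t such that both L and x L lie in the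
-- middle third modulo 2 n.
SpreadingMultiplier : ℕ → ℕ → Set
SpreadingMultiplier p q =
  ∃[ t ] t ≤ p × Far (1 + 2 * p) (2 * (1 + p * 3)) ((2 + q * 3) * (1 + 2 * p + 2 * t))

-- Here x L - (q + 1) 2n = q - 2p + 2xt, which has to lie between 2p + 1 and 4p + 1. The chosen `t`
-- is the largest that keeps it at most 4p + 1; it falls short of that by `ρ` < 2x ≤ 2p, so it is at
-- least 2p + 1.
x-far-small : ∀ p q → 2 < 2 + q * 3 → 2 + q * 3 ≤ p → SpreadingMultiplier p q
x-far-small p q 2<x x≤p = t , t≤p , suc q , r , xL≡ , h≤r , r+h≤M
  where
  open ≤-Reasoning
  x Y ρ t r : ℕ
  x = 2 + q * 3
  Y = 1 + 6 * p ∸ q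
  t = Y / (2 * x)
  ρ = Y % (2 * x)
  r = 1 + 4 * p ∸ ρ

  q≤p : q ≤ p
  q≤p = ≤-trans (≤-trans (m≤m*n q 3) (m≤n+m (q * 3) 2)) x≤p

  Y≡ : ρ + t * (2 * x) + q ≡ 1 + 6 * p
  Y≡ = trans (cong (_+ q) (sym (m≡m%n+[m/n]*n Y (2 * x))))
         (m∸n+n≡m (≤-trans q≤p (≤-trans (m≤n*m p 6) (n≤1+n (6 * p)))))

  ρ≤2p : ρ ≤ 2 * p
  ρ≤2p = ≤-trans (<⇒≤ (m%n<n Y (2 * x))) (*-monoʳ-≤ 2 x≤p)

  r≡ : r + ρ ≡ 1 + 4 * p
  r≡ = m∸n+n≡m (≤-trans ρ≤2p (≤-trans (*-monoˡ-≤ p {2} {4} (s≤s (s≤s z≤n))) (n≤1+n (4 * p))))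

  t≤p : t ≤ p
  -- As x ≥ 3, a `t` above p would give t · 2x ≥ 6p + 6, more than `Y` allows.
  t≤p = ≮⇒≥ λ p<t → <⇒≱ (begin-strict
    1 + 6 * p                      <⟨ m<m+n (1 + 6 * p) {5} z<s ⟩
    1 + 6 * p + 5                  ≡⟨ ring p ⟩
    suc p * 6                      ≤⟨ *-mono-≤ p<t (*-monoʳ-≤ 2 2<x) ⟩
    t * (2 * x)                    ∎)
    (begin
    t * (2 * x)                    ≤⟨ m≤n+m (t * (2 * x)) ρ ⟩
    ρ + t * (2 * x)                ≤⟨ m≤m+n _ q ⟩
    ρ + t * (2 * x) + q            ≡⟨ Y≡ ⟩
    1 + 6 * p                      ∎)
    where
    ring : ∀ p → 1 + 6 * p + 5 ≡ suc p * 6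
    ring = solve-∀

  h≤r : 1 + 2 * p ≤ r
  h≤r = +-cancelʳ-≤ ρ (1 + 2 * p) r (begin
    1 + 2 * p + ρ       ≤⟨ +-monoʳ-≤ (1 + 2 * p) ρ≤2p ⟩
    1 + 2 * p + 2 * p   ≡⟨ ring p ⟩
    1 + 4 * p           ≡⟨ r≡ ⟨
    r + ρ               ∎)
    where
    ring : ∀ p → 1 + 2 * p + 2 * p ≡ 1 + 4 * p
    ring = solve-∀

  r+h≤M : r + (1 + 2 * p) ≤ 2 * (1 + p * 3)
  r+h≤M = begin
    r + (1 + 2 * p)             ≤⟨ +-monoˡ-≤ (1 + 2 * p) (m∸n≤m (1 + 4 * p) ρ) ⟩
    1 + 4 * p + (1 + 2 * p)     ≡⟨ ring p ⟩
    2 * (1 + p * 3)             ∎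
    where
    ring : ∀ p → 1 + 4 * p + (1 + 2 * p) ≡ 2 * (1 + p * 3)
    ring = solve-∀

  xL≡ : x * (1 + 2 * p + 2 * t) ≡ r + suc q * (2 * (1 + p * 3))
  xL≡ = +-cancelʳ-≡ ρ _ _ (begin-equality
    x * (1 + 2 * p + 2 * t) + ρ
      ≡⟨ left p q t ρ ⟩
    ρ + t * (2 * x) + q + (6 * (p * q) + 2 * q + 4 * p + 2)
      ≡⟨ cong (_+ (6 * (p * q) + 2 * q + 4 * p + 2)) Y≡ ⟩
    1 + 6 * p + (6 * (p * q) + 2 * q + 4 * p + 2)
      ≡⟨ middle p q ⟩
    1 + 4 * p + suc q * (2 * (1 + p * 3))
      ≡⟨ cong (_+ suc q * (2 * (1 + p * 3))) r≡ ⟨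
    r + ρ + suc q * (2 * (1 + p * 3))
      ≡⟨ right r ρ (suc q * (2 * (1 + p * 3))) ⟩
    r + suc q * (2 * (1 + p * 3)) + ρ ∎)
    where
    left : ∀ p q t ρ → (2 + q * 3) * (1 + 2 * p + 2 * t) + ρ
      ≡ ρ + t * (2 * (2 + q * 3)) + q + (6 * (p * q) + 2 * q + 4 * p + 2)
    left = solve-∀
    middle : ∀ p q → 1 + 6 * p + (6 * (p * q) + 2 * q + 4 * p + 2) ≡ 1 + 4 * p + suc q * (2 * (1 + p * 3))
    middle = solve-∀
    right : ∀ r ρ e → r + ρ + e ≡ r + e + ρ
    right = solve-∀

-- The parameters are g = p − 2q − 1 and e = q − g, so that 2n − 4x = 6g.
x-far-large : ∀ g e .{{_ : NonZero g}} →
  SpreadingMultiplier (1 + 2 * (g + e) + g) (g + e)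
x-far-large g e = 2 * s , 2s≤p , q + s , 1 + 2 * p + ρ , xL≡ , m≤m+n (1 + 2 * p) ρ , r+h≤M
  where
  open ≤-Reasoning
  instance
    6g≢0 : NonZero (6 * g)
    6g≢0 = m*n≢0 6 g
  p q Y ρ s : ℕ
  p = 1 + 2 * (g + e) + g
  q = g + e
  -- At t = 0, x L exceeds q · 2n by 2p + 1 + `Y`. Each increase of t by 2 adds 2n - 6g, so after
  -- `s` of them only `ρ` is left above the lower end 2p + 1 of the third.
  Y = q + (1 + 2 * p)
  s = Y / (6 * g)
  ρ = Y % (6 * g)

  Y≡ : Y ≡ ρ + s * (6 * g)
  Y≡ = m≡m%n+[m/n]*n Y (6 * g)

  2s≤p : 2 * s ≤ p
  2s≤p = *-cancelˡ-≤ 3 (begin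
    3 * (2 * s)           ≡⟨ ring₁ s ⟩
    s * 6                 ≤⟨ *-monoʳ-≤ s (m≤m*n 6 g) ⟩
    s * (6 * g)           ≤⟨ m≤n+m (s * (6 * g)) ρ ⟩
    ρ + s * (6 * g)       ≡⟨ Y≡ ⟨
    Y                     ≤⟨ m≤m+n Y (2 * g + e) ⟩
    Y + (2 * g + e)       ≡⟨ ring₂ g e ⟩
    3 * p                 ∎)
    where
    ring₁ : ∀ s → 3 * (2 * s) ≡ s * 6
    ring₁ = solve-∀
    ring₂ : ∀ g e → g + e + (1 + 2 * (1 + 2 * (g + e) + g)) + (2 * g + e) ≡ 3 * (1 + 2 * (g + e) + g)
    ring₂ = solve-∀

  r+h≤M : 1 + 2 * p + ρ + (1 + 2 * p) ≤ 2 * (1 + p * 3)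
  r+h≤M = begin
    1 + 2 * p + ρ + (1 + 2 * p)
      ≤⟨ +-monoˡ-≤ (1 + 2 * p) (+-monoʳ-≤ (1 + 2 * p) (<⇒≤ (m%n<n Y (6 * g)))) ⟩
    1 + 2 * p + 6 * g + (1 + 2 * p)
      -- The third spans 2p = 6g + 2 + 4e, so a remainder of at most 6g fits.
      ≤⟨ m≤m+n _ (2 + 4 * e) ⟩
    1 + 2 * p + 6 * g + (1 + 2 * p) + (2 + 4 * e)
      ≡⟨ ring g e ⟩
    2 * (1 + p * 3) ∎
    where
    ring : ∀ g e → let p = 1 + 2 * (g + e) + g in
      1 + 2 * p + 6 * g + (1 + 2 * p) + (2 + 4 * e) ≡ 2 * (1 + p * 3)
    ring = solve-∀

  xL≡ : (2 + q * 3) * (1 + 2 * p + 2 * (2 * s)) ≡ 1 + 2 * p + ρ + (q + s) * (2 * (1 + p * 3))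
  xL≡ = begin-equality
    (2 + q * 3) * (1 + 2 * p + 2 * (2 * s))
      ≡⟨ left p q s ⟩
    Y + rest
      ≡⟨ cong (_+ rest) Y≡ ⟩
    ρ + s * (6 * g) + rest
      ≡⟨ right g e s ρ ⟩
    1 + 2 * p + ρ + (q + s) * (2 * (1 + p * 3)) ∎
    where
    rest : ℕ
    rest = 1 + 2 * p + q * (2 * (1 + p * 3)) + s * (12 * q + 8)
    left : ∀ p q s → (2 + q * 3) * (1 + 2 * p + 2 * (2 * s))
      ≡ q + (1 + 2 * p) + (1 + 2 * p + q * (2 * (1 + p * 3)) + s * (12 * q + 8))
    left = solve-∀
    right : ∀ g e s ρ →
      ρ + s * (6 * g) + (1 + 2 * (1 + 2 * (g + e) + g)
        + (g + e) * (2 * (1 + (1 + 2 * (g + e) + g) * 3)) + s * (12 * (g + e) + 8))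
      ≡ 1 + 2 * (1 + 2 * (g + e) + g) + ρ + (g + e + s) * (2 * (1 + (1 + 2 * (g + e) + g) * 3))
    right = solve-∀

private
  2q+2≤p : ∀ p q → 2 * (2 + q * 3) < 1 + p * 3 → 2 + 2 * q ≤ p
  2q+2≤p p q 2x<n = *-cancelʳ-< 3 (1 + 2 * q) p (≤-pred (subst (_< 1 + p * 3) (ring q) 2x<n))
    where
    ring : ∀ q → 2 * (2 + q * 3) ≡ 1 + (1 + 2 * q) * 3
    ring = solve-∀

  g<q : ∀ q g → 2 + q * 3 ≰ 2 + 2 * q + g → suc g ≤ q
  g<q q g x≰p = +-cancelˡ-≤ (2 + 2 * q) (suc g) q
    (subst₂ _≤_ (sym (+-suc (2 + 2 * q) g)) (ring q) (≰⇒> x≰p))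
    where
    ring : ∀ q → 2 + q * 3 ≡ 2 + 2 * q + q
    ring = solve-∀

x-far : ∀ p q → 2 < 2 + q * 3 → 2 * (2 + q * 3) < 1 + p * 3 → SpreadingMultiplier p q
x-far p q 2<x 2x<n with 2 + q * 3 ≤? p
... | yes x≤p = x-far-small p q 2<x x≤p
... | no x≰p with m≤n⇒∃[o]m+o≡n (2q+2≤p p q 2x<n)
-- This `g` is p - 2q - 2, so the parameter passed to `x-far-large` is its successor and hence
-- nonzero.
...   | g , refl with m≤n⇒∃[o]m+o≡n (g<q q g x≰p)
...     | e , refl =
  subst (λ p → SpreadingMultiplier p (suc g + e)) (+-suc (1 + 2 * (suc g + e)) g) (x-far-large (suc g) e)

-- Assembly for the graphs C₂ₙ(x,1,n).

private
  -- The quotients are arguments so that matching on `refl` replaces `n` and `x` throughout, in the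
  -- graph included.
  theorem25-quotients : ∀ p q n x (1<x : 1 < x) (x<n : x < n) → n ≡ 1 + p * 3 → x ≡ 2 + q * 3 →
    2 < x → 2 * x < n → WordRepresentable (C₂ₙ⟨ x ,1, n ⟩ 1<x x<n)
  theorem25-quotients p q n x 1<x x<n refl refl 2<x 2x<n with x-far p q 2<x 2x<n
  ... | t , t≤p , far-x = 
    colourable₃⇒wordRepresentable (C₂ₙ⟨ x ,1, n ⟩ 1<x x<n) (λ i j → circularDistance i j ∈? jumps)
      (arcColour (2 * n) jumps h L M≤3h far)
      (λ {i} {j} → arcColour-proper (2 * n) jumps h L M≤3h far {i} {j})
    where
    open DecMembership _≟ⁿ_ using (_∈?_)
    jumps : List ℕ
    jumps = x ∷ 1 ∷ n ∷ []
    open ≤-Reasoning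
    h L : ℕ
    h = 1 + 2 * p
    L = h + 2 * t

    M≤3h : 2 * n ≤ 3 * h
    M≤3h = ≤-trans (n≤1+n (2 * n)) (≤-reflexive (ring p))
      where
      ring : ∀ p → suc (2 * (1 + p * 3)) ≡ 3 * (1 + 2 * p)
      ring = solve-∀

    far-1 : Far h (2 * n) (1 * L)
    far-1 = 0 , L , refl , m≤m+n h (2 * t) , (begin
      h + 2 * t + h   ≤⟨ +-monoˡ-≤ h (+-monoʳ-≤ h (*-monoʳ-≤ 2 t≤p)) ⟩
      h + 2 * p + h   ≡⟨ ring p ⟩
      2 * n           ∎)
      where
      ring : ∀ p → 1 + 2 * p + 2 * p + (1 + 2 * p) ≡ 2 * (1 + p * 3)
      ring = solve-∀

    far-n : Far h (2 * n) (n * L)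
    -- L = 2 (p + t) + 1 is odd, so n L is n plus p + t multiples of 2n.
    far-n = p + t , n , ring p t , h≤n , ≤-trans (+-monoʳ-≤ n h≤n) (≤-reflexive (n+n≡2n n))
      where
      h≤n : h ≤ n
      h≤n = s≤s (subst (2 * p ≤_) (*-comm 3 p) (*-monoˡ-≤ p {2} {3} (s≤s (s≤s z≤n))))
      ring : ∀ p t → (1 + p * 3) * (1 + 2 * p + 2 * t) ≡ 1 + p * 3 + (p + t) * (2 * (1 + p * 3))
      ring = solve-∀
      n+n≡2n : ∀ n → n + n ≡ 2 * n
      n+n≡2n = solve-∀

    far : ∀ {d} → d ∈ jumps → Far h (2 * n) (d * L)
    far (here refl)                 = far-x
    far (there (here refl))         = far-1
    far (there (there (here refl))) = far-n

theorem25 : (n x : ℕ) (1<x : 1 < x) (x<n : x < n) →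
    n % 3 ≡ 1 → x % 3 ≡ 2 → 2 < x → 2 * x < n →
    WordRepresentable (C₂ₙ⟨ x ,1, n ⟩ 1<x x<n)
theorem25 n x 1<x x<n n%3≡1 x%3≡2 =
  theorem25-quotients (n / 3) (x / 3) n x 1<x x<n (decompose n n%3≡1) (decompose x x%3≡2)
  where
  decompose : ∀ k {r} → k % 3 ≡ r → k ≡ r + k / 3 * 3
  decompose k eq = trans (m≡m%n+[m/n]*n k 3) (cong (_+ k / 3 * 3) eq)
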